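{- (i) There exist $n \ge 5$ and a tree $T$ with vertex set $\{1,2,\ldots,n\}$ such that, with $\Gamma$ the Cayley graph of $S_n$ generated by $T$, $$\mathrm{diam}(\Gamma) < \max_{\pi \in S_n} \left\{ c(\pi)-n+\sum_{i=1}^n \mathrm{dist}_T(i,\pi(i)) \right\}.$$ (ii) There exist $n \ge 5$ and a tree $T$ with vertex set $\{1,2,\ldots,n\}$ for which the AK algorithm uses more than the minimum number of transpositions required; that is, there exist a permutation $\pi \in S_n$ and a run of the AK algorithm on $T$ starting from $\pi$ that uses more than $\mathrm{dist}_{\Gamma}(I,\pi)$ transpositions, where $\Gamma$ is the Cayley graph of $S_n$ generated by $T$.
   Context: $S_n$ is the symmetric group on $\{1,\ldots,n\}$ and $I$ is its identity; the product $\pi\tau$ means apply $\tau$ first, then $\pi$. For a tree $T$ on vertex set $\{1,\ldots,n\}$ (a transposition tree), each edge $ij$ is identified with the transposition $(i,j)$, and the Cayley graph $\Gamma$ generated by $T$ is the simple undirected graph with vertex set $S_n$ in which $g$ and $h$ are adjacent iff $h = gs$ for some transposition $s$ that is an edge of $T$. $\mathrm{dist}_G$ and $\mathrm{diam}(G)$ denote distance and diameter in a graph $G$. $c(\pi)$ is the number of cycles of $\pi$, including cycles of length 1. AK algorithm: given $T$ and $\pi \in S_n$, place marker $\pi(k)$ at each vertex $k$ of $T$. Applying the switch $(i,j)$ for an edge $ij$ of $T$ interchanges the markers at $i$ and $j$, i.e. replaces $\pi$ by $\pi(i,j)$. A marker $k$ is homed if it is at vertex $k$. An edge $ij$ of $T$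 is admissible for the current permutation $\pi$ if one of the following holds: (type A) applying the switch $(i,j)$ reduces the distance in $T$ from the marker at $i$ to its home vertex $\pi(i)$ and also reduces the distance from the marker at $j$ to its home vertex $\pi(j)$; or (type B) the marker at one of $i,j$ is homed, and the marker at the other vertex is not homed and applying the switch $(i,j)$ would reduce its distance to its home vertex (i.e. it needs to traverse the edge $ij$ on its way home). Whenever $\pi \ne I$ there is at least one admissible edge. A run of the AK algorithm from $\pi$ repeatedly chooses any admissible edge for the current permutation and applies the corresponding switch, until the current permutation is $I$ (every run terminates). The number of transpositions used is the number of switches applied. -}

module Defs where

open import Data.Fin using (Fin; toℕ)
open import Data.Fin.Permutation using (Permutation′; _⟨$⟩ʳ_; _⟨$⟩ˡ_; _≈_; _∘ₚ_; transpose; inverseˡ)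
  renaming (id to I)
open import Data.Fin.Permutation.Components using (transpose-inverse)
open import Data.Fin.Properties using (_≟_; any?)
open import Data.Fin.Subset using (Subset)
open import Data.Integer as ℤ using (ℤ)
open import Data.List using (List; _∷_; _∷ʳ_; length; map; allFin; deduplicate)
open import Data.List.Relation.Unary.Linked using (Linked)
open import Data.List.Relation.Unary.Unique.Propositional using (Unique)
open import Data.Nat using (ℕ; zero; suc; _≤_; _<_; z≤n; s≤s)
open import Data.Nat.GeneralisedArithmetic using (iterate)
open import Data.Nat.ListAction using (sum)
open import Data.Bool.Properties using () renaming (_≟_ to _≟ᵇ_)
open import Data.Product using (∃-syntax; ∃₂; _×_; _,_; proj₁; proj₂)
open import Data.Sum using (_⊎_)
open import Data.Vec using (tabulate)
open import Data.Vec.Properties using (≡-dec)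
open import Level using (0ℓ)
open import Relation.Binary.Bundles using (Setoid)
open import Relation.Binary.Definitions using (Decidable; Symmetric; Irreflexive; _Respects₂_)
open import Relation.Binary.PropositionalEquality as ≡ using (_≡_; refl; sym; trans; cong)
open import Relation.Nullary using (¬_; yes; no; does; contradiction)
open import Relation.Nullary.Decidable using (map′; _×-dec_; dec-true)
import Relation.Unary as U

-- Vertices form a setoid, because permutations are compared pointwise.
record Graph (V : Setoid 0ℓ 0ℓ) : Set₁ where
  private module V = Setoid V
  field
    Adj        : V.Carrier → V.Carrier → Set
    adj-sym    : Symmetric Adj
    adj-irrefl : Irreflexive V._≈_ Adj
    adj-resp   : Adj Respects₂ V._≈_

module _ {V : Setoid 0ℓ 0ℓ} (G : Graph V) where
  private module V = Setoid V
  open Graph G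

  data Walk : V.Carrier → V.Carrier → ℕ → Set where
    []  : ∀ {u v} → u V.≈ v → Walk u v 0
    _∷_ : ∀ {u v w k} → Adj u v → Walk v w k → Walk u w (suc k)

  IsDistance : V.Carrier → V.Carrier → ℕ → Set
  IsDistance u v d = Walk u v d × (∀ {k} → Walk u v k → d ≤ k)

  IsDiameter : ℕ → Set
  IsDiameter d =
    (∀ u v → ∃[ k ] (IsDistance u v k × k ≤ d)) × (∃₂ λ u v → IsDistance u v d)

  Connected : Set
  Connected = ∀ u v → ∃[ k ] Walk u v k

-- A cycle through the distinct vertices u, v₁, …, vₖ, in that order (k ≥ 2).
IsCycle : ∀ {n} → Graph (≡.setoid (Fin n)) → Fin n → List (Fin n) → Set
IsCycle G u vs =
  2 ≤ length vs × Unique (u ∷ vs) × Linked (Graph.Adj G) ((u ∷ vs) ∷ʳ u)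

record Tree (n : ℕ) : Set₁ where
  field
    graph     : Graph (≡.setoid (Fin n))
    -- Classically automatic; it makes the distance in the tree a function.
    adj?      : Decidable (Graph.Adj graph)
    connected : Connected graph
    acyclic   : ∀ u vs → ¬ IsCycle graph u vs
  open Graph graph public

least : ∀ {P : ℕ → Set} → U.Decidable P → ∀ k → P k →
        ∃[ m ] (P m × (∀ {j} → P j → m ≤ j))
least P? zero    p = 0 , p , λ _ → z≤n
least P? (suc k) p with P? 0
... | yes p₀ = 0 , p₀ , λ _ → z≤n
... | no ¬p₀ with least (λ j → P? (suc j)) k p
...   | m , pm , min = suc m , pm ,
        λ { {zero} q → contradiction q ¬p₀ ; {suc j} q → s≤s (min q) }

module _ {n : ℕ} (T : Tree n) where
  open Tree T

  walk? : ∀ u v → U.Decidable (Walk graph u v)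
  walk? u v zero    = map′ [] (λ { ([] u≡v) → u≡v }) (u ≟ v)
  walk? u v (suc k) =
    map′ (λ { (_ , a , p) → a ∷ p }) (λ { (a ∷ p) → _ , a , p })
         (any? λ w → adj? u w ×-dec walk? w v k)

  distance : ∀ u v → ∃[ d ] IsDistance graph u v d
  distance u v = least (walk? u v) (proj₁ (connected u v)) (proj₂ (connected u v))

  dist : Fin n → Fin n → ℕ
  dist u v = proj₁ (distance u v)

infixl 7 _·_

-- π · τ applies τ first; the library's _∘ₚ_ applies its left argument first.
_·_ : ∀ {n} → Permutation′ n → Permutation′ n → Permutation′ n
π · τ = τ ∘ₚ π

-- The vertex set of the cycle of π through i; exponents below n suffice.
orbit : ∀ {n} → Permutation′ n → Fin n → Subset n
orbit {n} π i = tabulate λ j →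
  does (any? {n = n} λ k → iterate (π ⟨$⟩ʳ_) i (toℕ k) ≟ j)

-- Fixed points count as cycles.
c : ∀ {n} → Permutation′ n → ℕ
c {n} π = length (deduplicate (≡-dec _≟ᵇ_) (map (orbit π) (allFin n)))

Sym : ℕ → Setoid 0ℓ 0ℓ
Sym n = record
  { Carrier       = Permutation′ n
  ; _≈_           = _≈_
  ; isEquivalence = record
    { refl  = λ _ → refl
    ; sym   = λ p i → sym (p i)
    ; trans = λ p q i → trans (p i) (q i)
    }
  }

transpose-left : ∀ {n} (i j : Fin n) → transpose i j ⟨$⟩ʳ i ≡ j
transpose-left i j rewrite dec-true (i ≟ i) refl = refl

Cayley : ∀ {n} → Tree n → Graph (Sym n)
Cayley {n} T = record
  { Adj        = CayleyAdj
  ; adj-sym    = λ {g} {h} (i , j , e , h≈gs) → j , i , adj-sym e ,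
                   λ k → sym (trans (h≈gs (transpose j i ⟨$⟩ʳ k))
                                    (cong (g ⟨$⟩ʳ_) (transpose-inverse i j)))
  ; adj-irrefl = λ {g} {h} g≈h (i , j , e , h≈gs) →
                   adj-irrefl (injective g (trans (g≈h i) (trans (h≈gs i)
                     (cong (g ⟨$⟩ʳ_) (transpose-left i j))))) e
  ; adj-resp   =
      (λ h≈h′ (i , j , e , h≈gs) → i , j , e , λ k → trans (sym (h≈h′ k)) (h≈gs k))
    , (λ g≈g′ (i , j , e , h≈gs) → i , j , e , λ k → trans (h≈gs k) (g≈g′ _))
  }
  where
  open Tree T

  CayleyAdj : Permutation′ n → Permutation′ n → Set
  CayleyAdj g h = ∃₂ λ i j → Adj i j × h ≈ g · transpose i j

  injective : ∀ (g : Permutation′ n) {i j} → g ⟨$⟩ʳ i ≡ g ⟨$⟩ʳ j → i ≡ j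
  injective g eq = trans (sym (inverseˡ g)) (trans (cong (g ⟨$⟩ˡ_) eq) (inverseˡ g))

IsMaximum : ∀ {A : Set} → (A → ℤ) → ℤ → Set
IsMaximum f m = (∃[ x ] f x ≡ m) × (∀ x → f x ℤ.≤ m)

cycleDistance : ∀ {n} → Tree n → Permutation′ n → ℤ
cycleDistance {n} T π =
  ℤ.+ c π ℤ.- ℤ.+ n ℤ.+ ℤ.+ sum (map (λ i → dist T i (π ⟨$⟩ʳ i)) (allFin n))

module _ {n : ℕ} (T : Tree n) where
  open Tree T

  -- The marker at vertex i is π i, and its home is the vertex π i.
  Homed : Permutation′ n → Fin n → Set
  Homed π i = π ⟨$⟩ʳ i ≡ i

  -- Moving the marker at i to j brings it closer to its home.
  Closer : Permutation′ n → Fin n → Fin n → Set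
  Closer π i j = dist T j (π ⟨$⟩ʳ i) < dist T i (π ⟨$⟩ʳ i)

  TypeA TypeB Admissible : Permutation′ n → Fin n → Fin n → Set
  TypeA π i j = Closer π i j × Closer π j i
  TypeB π i j = (Homed π i × ¬ Homed π j × Closer π j i)
              ⊎ (Homed π j × ¬ Homed π i × Closer π i j)
  Admissible π i j = Adj i j × (TypeA π i j ⊎ TypeB π i j)

  -- AKRun π k: some run of the algorithm from π applies exactly k switches.
  data AKRun : Permutation′ n → ℕ → Set where
    done   : ∀ {π} → π ≈ I → AKRun π 0
    switch : ∀ {π k} i j → ¬ π ≈ I → Admissible π i j →
             AKRun (π · transpose i j) k → AKRun π (suc k)

{-# OPTIONS --safe #-}
module Submission where

-- A switch that moves both markers closer to home while merging two cycles
-- lowers the cycle distance c(π) − n + Σ dist(i, π i) by three instead of one.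
-- On the tree with edges 01, 12, 23, 24, the distance in Γ from I to π is the
-- cycle distance, less two if 1 lies in a nontrivial cycle of π avoiding both 0
-- and 2 while 0 is not fixed: this function vanishes only at I, changes by at
-- most one along each edge of Γ, and decreases along some edge at every π ≠ I.
-- Its maximum is 7, whereas (0 4)(1 3) has cycle distance 8 and length 6, and
-- some AK run from it uses 8 switches.

open import Defs
open import Data.Bool using (if_then_else_)
open import Data.Fin using (Fin; zero; suc; toℕ; punchIn)
open import Data.Fin.Patterns using (0F; 1F; 2F; 3F; 4F)
open import Data.Fin.Permutation
  using (Permutation′; _⟨$⟩ʳ_; _≈_; transpose; insert; remove; insert-remove; flip; inverseʳ)
  renaming (id to I)
open import Data.Fin.Properties using (_≟_; all?; any?)
open import Data.Fin.Subset using (_∈_; _∉_)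
open import Data.Fin.Subset.Properties using (_∈?_; anySubset?)
open import Data.Integer as ℤ using (ℤ; ∣_∣)
import Data.Integer.Properties as ℤ
open import Data.List using (List; []; _∷_; _∷ʳ_; map; length; allFin; deduplicate)
import Data.List.Membership.DecPropositional as DecMembership
import Data.List.Membership.Propositional as List
open import Data.List.Properties using (map-cong)
open import Data.List.Relation.Unary.All using (All; []; _∷_)
open import Data.List.Relation.Unary.AllPairs using (_∷_)
open import Data.List.Relation.Unary.Linked using (Linked; _∷_)
open import Data.Nat as ℕ using (ℕ; zero; suc; _≤_; _<_; s≤s)
open import Data.Nat.GeneralisedArithmetic using (iterate)
open import Data.Nat.ListAction using (sum)
open import Data.Nat.Properties using (≤-refl; ≤-reflexive; ≤-trans; n≤1+n; suc-injective)
open import Data.Product using (Σ-syntax; ∃-syntax; ∃₂; _×_; _,_; proj₁; proj₂)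
open import Data.Product.Properties using (≡-dec)
open import Data.Sum as Sum using (_⊎_; inj₁; inj₂)
open import Data.Vec.Properties using (tabulate-cong)
open import Function using (_∘_; mk⇔)
import Relation.Binary.Definitions as B
open import Relation.Binary.PropositionalEquality as ≡
  using (_≡_; _≢_; refl; sym; trans; cong; cong₂; subst; subst₂)
open import Relation.Nullary using (Dec; ¬_; ¬?; does; contradiction)
open import Relation.Nullary.Decidable using (map′; _×-dec_; _⊎-dec_; _→-dec_; toWitness; does-⇔)
open import Relation.Unary using (Decidable)

-- Connectedness and bridges in finite graphs.

module _ {n : ℕ} (G : Graph (≡.setoid (Fin n))) where
  open Graph G

  _++ʷ_ : ∀ {u v w k l} → Walk G u v k → Walk G v w l → Walk G u w (k ℕ.+ l)
  [] refl ++ʷ q = q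
  (a ∷ p) ++ʷ q = a ∷ (p ++ʷ q)

  reverse : ∀ {u v k} → Walk G u v k → ∃[ l ] Walk G v u l
  reverse ([] refl) = 0 , [] refl
  reverse (a ∷ p)   = _ , (proj₂ (reverse p) ++ʷ (adj-sym a ∷ [] refl))

  connected-through : ∀ r → (∀ u → ∃[ k ] Walk G u r k) → Connected G
  connected-through r to-r u v = _ , (proj₂ (to-r u) ++ʷ proj₂ (reverse (proj₂ (to-r v))))

  -- The cut set `S` is a certificate: `u → v` is the only step leaving it. Phrased this way, being
  -- a bridge is decided by a search over subsets, with no reference to walks or cycles.
  IsBridge : Fin n → Fin n → Set
  IsBridge u v = ∃[ S ] (u ∈ S × v ∉ S × (∀ x y → Adj x y → x ∈ S → y ∉ S → x ≡ u × y ≡ v))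

  isBridge? : B.Decidable Adj → ∀ u v → Dec (IsBridge u v)
  isBridge? adj? u v = anySubset? λ S →
    u ∈? S ×-dec ¬? (v ∈? S) ×-dec
    all? λ x → all? λ y →
      adj? x y →-dec x ∈? S →-dec ¬? (y ∈? S) →-dec (x ≟ u ×-dec y ≟ v)

  -- After its first step u → v, a cycle cannot cross the bridge back.
  bridges⇒acyclic : (∀ u v → Adj u v → IsBridge u v) → ∀ u vs → ¬ IsCycle G u vs
  bridges⇒acyclic bridge u (_ ∷ []) (s≤s () , _)
  bridges⇒acyclic bridge u (v ∷ w ∷ vs)
    (_ , (_ ∷ u≢w ∷ _) ∷ (v≢w ∷ v≢vs) ∷ _ , a ∷ b ∷ l) with bridge u v a
  ... | S , u∈S , v∉S , crossing = trapped w vs w∉S (v≢w ∷ v≢vs) l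
    where
    w∉S : w ∉ S
    w∉S w∈S = u≢w (sym (proj₁ (crossing w v (adj-sym b) w∈S v∉S)))

    trapped : ∀ x xs → x ∉ S → All (v ≢_) (x ∷ xs) → ¬ Linked Adj ((x ∷ xs) ∷ʳ u)
    trapped x []       x∉S (v≢x ∷ _) (c ∷ _)  = v≢x (sym (proj₂ (crossing u x (adj-sym c) u∈S x∉S)))
    trapped x (y ∷ xs) x∉S (v≢x ∷ v≢) (c ∷ l) =
      trapped y xs (λ y∈S → v≢x (sym (proj₂ (crossing y x (adj-sym c) y∈S x∉S)))) v≢ l

-- Exhaustive search over permutations, and invariance under pointwise equality.

∀-permutation? : ∀ n {P : Permutation′ n → Set} →
                 (∀ {π ρ} → π ≈ ρ → P π → P ρ) → Decidable P → Dec (∀ π → P π)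
∀-permutation? zero    resp P? = map′ (λ p π → resp (λ ()) p) (λ p → p I) (P? I)
∀-permutation? (suc n) resp P? = map′
  -- A permutation is determined by its value at `zero` and by what remains after deleting that
  -- point. It is recovered from these only pointwise, hence the appeal to `resp`.
  (λ p π → resp (insert-remove zero π) (p (π ⟨$⟩ʳ zero) (remove zero π)))
  (λ p i ρ → p (insert zero i ρ))
  (all? λ i → ∀-permutation? n (resp ∘ insert-cong i) (P? ∘ insert zero i))
  where
  insert-cong : ∀ i {π ρ : Permutation′ n} → π ≈ ρ → insert zero i π ≈ insert zero i ρ
  insert-cong i π≈ρ zero    = refl
  insert-cong i π≈ρ (suc k) = cong (punchIn i) (π≈ρ k)

iterate-cong : ∀ {A : Set} {f g : A → A} → (∀ x → f x ≡ g x) → ∀ x k → iterate f x k ≡ iterate g x k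
iterate-cong f≗g x zero = refl
iterate-cong {g = g} f≗g x (suc k) = trans (iterate-cong f≗g _ k) (cong (λ y → iterate g y k) (f≗g x))

module _ {n : ℕ} (π ρ : Permutation′ n) (π≈ρ : π ≈ ρ) where

  orbit-cong : ∀ i → orbit π i ≡ orbit ρ i
  orbit-cong i = tabulate-cong λ j → does-⇔
    (mk⇔ (λ (k , eq) → k , trans (sym (iterate-cong π≈ρ i (toℕ k))) eq)
         (λ (k , eq) → k , trans (iterate-cong π≈ρ i (toℕ k)) eq))
    (any? {n = n} λ k → iterate (π ⟨$⟩ʳ_) i (toℕ k) ≟ j)
    (any? {n = n} λ k → iterate (ρ ⟨$⟩ʳ_) i (toℕ k) ≟ j)

  c-cong : c π ≡ c ρ
  c-cong = cong (length ∘ deduplicate _) (map-cong orbit-cong (allFin n))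

  cycleDistance-cong : (T : Tree n) → cycleDistance T π ≡ cycleDistance T ρ
  cycleDistance-cong T = cong₂ (λ x y → ℤ.+ x ℤ.- ℤ.+ n ℤ.+ ℤ.+ y) c-cong
    (cong sum (map-cong (λ i → cong (dist T i) (π≈ρ i)) (allFin n)))

-- Certificates for distances in the Cayley graph and for runs of the algorithm.

module _ {n : ℕ} (T : Tree n) where
  open Tree T

  -- These properties pin `ℓ` down as the distance to `I`: by `lipschitz` no walk to `I` is shorter
  -- than `ℓ`, and following `descent` gives a walk of exactly that length.
  record IsLength (ℓ : Permutation′ n → ℕ) : Set where
    field
      ℓ-cong    : ∀ {π ρ} → π ≈ ρ → ℓ π ≡ ℓ ρ
      ℓ-I       : ℓ I ≡ 0
      lipschitz : ∀ π i j → Adj i j → ℓ π ≤ suc (ℓ (π · transpose i j))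
      descent   : ∀ π → π ≈ I ⊎ ∃₂ λ i j → Adj i j × ℓ π ≡ suc (ℓ (π · transpose i j))

  module _ {ℓ : Permutation′ n → ℕ} (isLength : IsLength ℓ) where
    open IsLength isLength

    -- Γ is invariant under left multiplication.
    length⇒distance : ∀ u v → IsDistance (Cayley T) u v (ℓ (flip v · u))
    length⇒distance u v = walk u refl , shortest
      where
      walk : ∀ {k} w → ℓ (flip v · w) ≡ k → Walk (Cayley T) w v k
      walk w eq with descent (flip v · w)
      walk w eq | inj₁ v⁻¹w≈I with trans (sym eq) (trans (ℓ-cong v⁻¹w≈I) ℓ-I)
      ... | refl = [] λ i → trans (sym (inverseʳ v)) (cong (v ⟨$⟩ʳ_) (v⁻¹w≈I i))
      walk {zero}  w eq | inj₂ (i , j , a , drop) = contradiction (trans (sym eq) drop) λ ()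
      walk {suc k} w eq | inj₂ (i , j , a , drop) =
        (i , j , a , λ _ → refl) ∷ walk (w · transpose i j)
          -- The two bracketings of the product of `flip v`, `w` and the transposition act
          -- identically on every point, so `ℓ-cong` with `refl` passes between them.
          (suc-injective (trans (sym (trans drop (cong suc (ℓ-cong λ _ → refl)))) eq))

      shortest : ∀ {w k} → Walk (Cayley T) w v k → ℓ (flip v · w) ≤ k
      shortest ([] w≈v) = ≤-reflexive (trans (ℓ-cong λ i →
        trans (cong (flip v ⟨$⟩ʳ_) (w≈v i)) (inverseʳ (flip v))) ℓ-I)
      shortest {w} (_∷_ {v = x} (i , j , a , x≈wt) p) = ≤-trans (lipschitz (flip v · w) i j a)
        (s≤s (≤-trans (≤-reflexive (ℓ-cong λ k → cong (flip v ⟨$⟩ʳ_) (sym (x≈wt k)))) (shortest p)))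

  closer? : ∀ π i j → Dec (Closer T π i j)
  closer? π i j = dist T j (π ⟨$⟩ʳ i) ℕ.<? dist T i (π ⟨$⟩ʳ i)

  homed? : ∀ π i → Dec (Homed T π i)
  homed? π i = π ⟨$⟩ʳ i ≟ i

  admissible? : ∀ π i j → Dec (Admissible T π i j)
  admissible? π i j = adj? i j ×-dec
    ((closer? π i j ×-dec closer? π j i) ⊎-dec
     ((homed? π i ×-dec ¬? (homed? π j) ×-dec closer? π j i) ⊎-dec
      (homed? π j ×-dec ¬? (homed? π i) ×-dec closer? π i j)))

  ≈I? : ∀ (π : Permutation′ n) → Dec (π ≈ I)
  ≈I? π = all? (homed? π)

  -- Fixing the list of switches in advance makes the validity of a run decidable by recursion, so a
  -- concrete run can be checked by evaluation.
  Run : Permutation′ n → List (Fin n × Fin n) → Set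
  Run π []             = π ≈ I
  Run π ((i , j) ∷ es) = ¬ π ≈ I × Admissible T π i j × Run (π · transpose i j) es

  run? : ∀ π es → Dec (Run π es)
  run? π []             = ≈I? π
  run? π ((i , j) ∷ es) = ¬? (≈I? π) ×-dec admissible? π i j ×-dec run? (π · transpose i j) es

  run⇒AKRun : ∀ {π} es → Run π es → AKRun T π (length es)
  run⇒AKRun []             π≈I           = done π≈I
  run⇒AKRun ((i , j) ∷ es) (π≉I , a , r) = switch i j π≉I a (run⇒AKRun es r)

-- The tree: a vertex 2 of degree three with leaves 3 and 4 and the path 2, 1, 0.

fork : Tree 5
fork = record
  { graph     = graph
  ; adj?      = adj?
  ; connected = connected-through graph 2F λ where
      0F → _ , toWitness {a? = adj? 0F 1F} _ ∷ toWitness {a? = adj? 1F 2F} _ ∷ [] refl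
      1F → _ , toWitness {a? = adj? 1F 2F} _ ∷ [] refl
      2F → _ , [] refl
      3F → _ , toWitness {a? = adj? 3F 2F} _ ∷ [] refl
      4F → _ , toWitness {a? = adj? 4F 2F} _ ∷ [] refl
  ; acyclic   = bridges⇒acyclic graph
      -- Deleting an edge splits the tree in two, and the search finds the side containing `u` among
      -- the 32 subsets, for both orientations of each edge.
      (toWitness {a? = all? λ u → all? λ v → adj? u v →-dec isBridge? graph adj? u v} _)
  }
  where
  edges : List (Fin 5 × Fin 5)
  edges = (0F , 1F) ∷ (1F , 2F) ∷ (2F , 3F) ∷ (2F , 4F) ∷ []

  _∈ₑ?_ = DecMembership._∈?_ (≡-dec (_≟_ {5}) _≟_)

  adj? : ∀ u v → Dec ((u , v) List.∈ edges ⊎ (v , u) List.∈ edges)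
  adj? u v = ((u , v) ∈ₑ? edges) ⊎-dec ((v , u) ∈ₑ? edges)

  graph : Graph (≡.setoid (Fin 5))
  graph = record
    { Adj        = λ u v → (u , v) List.∈ edges ⊎ (v , u) List.∈ edges
    ; adj-sym    = Sum.swap
    ; adj-irrefl = λ { {u} refl → toWitness {a? = all? λ u → ¬? (adj? u u)} _ u }
    ; adj-resp   = (λ { refl a → a }) , (λ { refl a → a })
    }

-- The length function of the tree.

open Tree fork using (Adj; adj?)

-- Here the cycle of 1 joins it to leaves beyond 2, and the cycle of 0, being nontrivial and missing
-- 1, also reaches past 1. So two distinct cycles use the edge 12, and markers of the two can pass
-- each other there, merging the cycles with the saving of two.
Exceptional : Permutation′ 5 → Set
Exceptional π = π ⟨$⟩ʳ 0F ≢ 0F × π ⟨$⟩ʳ 1F ≢ 1F × 0F ∉ orbit π 1F × 2F ∉ orbit π 1F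

exceptional? : Decidable Exceptional
exceptional? π = ¬? (homed? fork π 0F) ×-dec ¬? (homed? fork π 1F) ×-dec
                 ¬? (0F ∈? orbit π 1F) ×-dec ¬? (2F ∈? orbit π 1F)

-- Neither `∣_∣` nor `∸` distorts the value. Every moved point adds at least 1 to the distance sum,
-- and there are at least n - c(π) of them, so the cycle distance is nonnegative. At an exceptional
-- permutation the sum is at least 8 and n - c(π) at most 3, leaving more than 2.
ℓ : Permutation′ 5 → ℕ
ℓ π = ∣ cycleDistance fork π ∣ ℕ.∸ (if does (exceptional? π) then 2 else 0)

exceptional-cong : ∀ π ρ → π ≈ ρ → Exceptional π → Exceptional ρ
exceptional-cong π ρ π≈ρ (π0≢0 , π1≢1 , 0∉ , 2∉) =
  π0≢0 ∘ trans (π≈ρ 0F) , π1≢1 ∘ trans (π≈ρ 1F) ,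
  subst (0F ∉_) (orbit-cong π ρ π≈ρ 1F) 0∉ , subst (2F ∉_) (orbit-cong π ρ π≈ρ 1F) 2∉

ℓ-cong : ∀ π ρ → π ≈ ρ → ℓ π ≡ ℓ ρ
ℓ-cong π ρ π≈ρ = cong₂ (λ x b → ∣ x ∣ ℕ.∸ (if b then 2 else 0))
  (cycleDistance-cong π ρ π≈ρ fork)
  (does-⇔ (mk⇔ (exceptional-cong π ρ π≈ρ) (exceptional-cong ρ π (sym ∘ π≈ρ)))
    (exceptional? π) (exceptional? ρ))

-- Evaluated at all 120 permutations built by `insert`; congruence of `ℓ` carries the bound to every
-- other representative.
ℓ≤7 : ∀ π → ℓ π ≤ 7
ℓ≤7 = toWitness {a? = ∀-permutation? 5
  (λ {π} {ρ} π≈ρ → subst (_≤ 7) (ℓ-cong π ρ π≈ρ))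
  (λ π → ℓ π ℕ.≤? 7)} _

cycleDistance≤8 : ∀ π → cycleDistance fork π ℤ.≤ ℤ.+ 8
cycleDistance≤8 = toWitness {a? = ∀-permutation? 5
  (λ {π} {ρ} π≈ρ → subst (ℤ._≤ ℤ.+ 8) (cycleDistance-cong π ρ π≈ρ fork))
  (λ π → cycleDistance fork π ℤ.≤? ℤ.+ 8)} _

ℓ-lipschitz : ∀ π i j → Adj i j → ℓ π ≤ suc (ℓ (π · transpose i j))
ℓ-lipschitz = toWitness {a? = ∀-permutation? 5
  (λ {π} {ρ} π≈ρ lip i j a → subst₂ (λ x y → x ≤ suc y) (ℓ-cong π ρ π≈ρ)
    (ℓ-cong (π · transpose i j) (ρ · transpose i j) (λ _ → π≈ρ _)) (lip i j a))
  (λ π → all? λ i → all? λ j → adj? i j →-dec ℓ π ℕ.≤? suc (ℓ (π · transpose i j)))} _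

ℓ-descent : ∀ π → π ≈ I ⊎ ∃₂ λ i j → Adj i j × ℓ π ≡ suc (ℓ (π · transpose i j))
ℓ-descent = toWitness {a? = ∀-permutation? 5
  (λ {π} {ρ} π≈ρ → Sum.map (λ π≈I i → trans (sym (π≈ρ i)) (π≈I i))
    λ (i , j , a , drop) → i , j , a , subst₂ (λ x y → x ≡ suc y) (ℓ-cong π ρ π≈ρ)
      (ℓ-cong (π · transpose i j) (ρ · transpose i j) (λ _ → π≈ρ _)) drop)
  (λ π → ≈I? fork π ⊎-dec
    any? λ i → any? λ j → adj? i j ×-dec ℓ π ℕ.≟ suc (ℓ (π · transpose i j)))} _

ℓ-isLength : IsLength fork ℓ
ℓ-isLength = record
  { ℓ-cong    = λ {π} {ρ} → ℓ-cong π ρ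
  ; ℓ-I       = refl
  ; lipschitz = ℓ-lipschitz
  ; descent   = ℓ-descent
  }

ℓ-distance : ∀ u v → IsDistance (Cayley fork) u v (ℓ (flip v · u))
ℓ-distance = length⇒distance fork ℓ-isLength

-- The extremal permutations and a wasteful run.

farthest doubleSwap : Permutation′ 5
-- This is the cycle 0 → 4 → 3 → 0 together with (1 2). The cycle of 1 contains 2, so nothing is
-- subtracted from the cycle distance 2 - 5 + 10 = 7.
farthest   = transpose 1F 2F · transpose 0F 3F · transpose 0F 4F
doubleSwap = transpose 0F 4F · transpose 1F 3F

-- The first three switches exchange the markers at 1 and 3, the other five those at 0 and 4. The
-- two 2-cycles are never merged with each other, so every switch lowers the cycle distance by just
-- one.
akSwitches : List (Fin 5 × Fin 5)
akSwitches = (1F , 2F) ∷ (2F , 3F) ∷ (1F , 2F) ∷ (0F , 1F) ∷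
             (1F , 2F) ∷ (2F , 4F) ∷ (1F , 2F) ∷ (0F , 1F) ∷ []

theorem10 : (∃[ n ] (5 ≤ n × (Σ[ T ∈ Tree n ] ∃[ d ] ∃[ m ]
    (IsDiameter (Cayley T) d × IsMaximum (cycleDistance T) m × ℤ.+ d ℤ.< m))))
    ×
    (∃[ n ] (5 ≤ n × (Σ[ T ∈ Tree n ] ∃[ π ] ∃[ k ] ∃[ d ]
    (AKRun T π k × IsDistance (Cayley T) I π d × d < k))))
theorem10 =
  (5 , ≤-refl , fork , 7 , ℤ.+ 8 ,
    ((λ u v → ℓ (flip v · u) , ℓ-distance u v , ℓ≤7 (flip v · u)) ,
     (farthest , I , ℓ-distance farthest I)) ,
    ((doubleSwap , refl) , cycleDistance≤8) ,
    ℤ.+<+ ≤-refl) ,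
  (5 , ≤-refl , fork , doubleSwap , 8 , 6 ,
    run⇒AKRun fork akSwitches (toWitness {a? = run? fork doubleSwap akSwitches} _) ,
    -- `doubleSwap` is its own inverse and exceptional, so the distance evaluates to 8 - 2 = 6.
    ℓ-distance I doubleSwap ,
    n≤1+n 7)
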